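{- There is a polynomial $p$ such that for any two shape graphs $H$ and $K$ with $L(H)\not\subseteq L(K)$, there exists a simple graph $G\in L(H)\setminus L(K)$ whose size is at most $2^{p(|H|+|K|)}$.
   Context: Fix a finite set $\Sigma$ of edge labels. An interval $[n;m]$ with $n\in\mathbb N$, $m\in\mathbb N\cup\{\infty\}$, $n\le m$, denotes $\{i\in\mathbb N: n\le i\le m\}$. Define $[n_1;m_1]\oplus[n_2;m_2]=[n_1+n_2;m_1+m_2]$, the empty $\oplus$-sum being $[0;0]$; $\subseteq$ between intervals is set inclusion. The basic intervals are $[1;1]$, $[0;1]$, $[1;\infty]$, $[0;\infty]$. A graph is a tuple $G=(N_G,E_G,\mathsf{source}_G,\mathsf{target}_G,\mathsf{lab}_G,\mathsf{occur}_G)$ with finite sets $N_G$ of nodes and $E_G$ of edges, $\mathsf{source}_G,\mathsf{target}_G:E_G\to N_G$, $\mathsf{lab}_G:E_G\to\Sigma$, and $\mathsf{occur}_G$ assigning an interval to each edge. Let $\mathsf{out}_G(n)=\{e\in E_G:\mathsf{source}_G(e)=n\}$. A graph is simple if every edge has interval $[1;1]$ and no two distinct edges have the same source, target and label. A shape graph is a graph using only basic intervals. The size $|G|$ of a graph is the number of its nodes and edges. For graphs $G,H$, a relation $R\subseteq N_G\times N_H$ is a simulation if for every $(n,m)\in R$ there is a function $\lambda:\mathsf{out}_G(n)\to\mathsf{out}_H(m)$ such that for every $e\in\mathsf{out}_G(n)$: $\mathsf{lab}_G(e)=\mathsf{lab}_H(\lambda(e))$ and $(\mathsf{target}_G(e),\mathsf{target}_H(\lambda(e)))\in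 R$; and for every $f\in\mathsf{out}_H(m)$: $\bigoplus\{\mathsf{occur}_G(e): e\in\mathsf{out}_G(n),\lambda(e)=f\}\subseteq\mathsf{occur}_H(f)$. An embedding is a simulation whose domain is all of $N_G$; write $G\preccurlyeq H$ if one exists. $L(H)$ is the set of simple graphs $G$ with $G\preccurlyeq H$. -}

module Defs where

open import Data.Nat using (ℕ; zero; suc; _+_; _*_; _^_; _≤_)
open import Data.Nat.Properties using (+-mono-≤)
open import Data.Fin using (Fin; _≟_)
open import Data.List using (List; []; _∷_; foldr)
open import Data.Product using (Σ; ∃; _×_; _,_)
open import Data.Sum using (_⊎_)
open import Data.Unit using (⊤; tt)
open import Data.Empty using (⊥)
open import Relation.Nullary using (¬_; yes; no)
open import Relation.Binary.PropositionalEquality using (_≡_)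

data ℕ∞ : Set where
  fin : ℕ → ℕ∞
  ∞   : ℕ∞

_≤∞_ : ℕ → ℕ∞ → Set
n ≤∞ fin m = n ≤ m
n ≤∞ ∞     = ⊤

_+∞_ : ℕ∞ → ℕ∞ → ℕ∞
fin a +∞ fin b = fin (a + b)
fin _ +∞ ∞     = ∞
∞     +∞ _     = ∞

+-mono-≤∞ : ∀ {a b} {x y : ℕ∞} → a ≤∞ x → b ≤∞ y → (a + b) ≤∞ (x +∞ y)
+-mono-≤∞ {x = fin x} {fin y} p q = +-mono-≤ p q
+-mono-≤∞ {x = fin x} {∞}     p q = tt
+-mono-≤∞ {x = ∞}     {y}     p q = tt

record Interval : Set where
  constructor interval
  field
    lo    : ℕ
    hi    : ℕ∞
    lo≤hi : lo ≤∞ hi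
open Interval public

_∈I_ : ℕ → Interval → Set
i ∈I I = (lo I ≤ i) × (i ≤∞ hi I)

_⊆I_ : Interval → Interval → Set
I ⊆I J = ∀ i → i ∈I I → i ∈I J

_⊕_ : Interval → Interval → Interval
I ⊕ J = interval (lo I + lo J) (hi I +∞ hi J) (+-mono-≤∞ (lo≤hi I) (lo≤hi J))

I00 : Interval
I00 = interval 0 (fin 0) Data.Nat.z≤n

IsBasic : Interval → Set
IsBasic I =
    (lo I ≡ 1 × hi I ≡ fin 1)
  ⊎ (lo I ≡ 0 × hi I ≡ fin 1)
  ⊎ (lo I ≡ 1 × hi I ≡ ∞)
  ⊎ (lo I ≡ 0 × hi I ≡ ∞)

data Opt (A : Set) : Set where
  none : Opt A
  some : A → Opt A

⊕ᶠ : ∀ {m} → (Fin m → Opt Interval) → Interval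
⊕ᶠ {zero}  f = I00
⊕ᶠ {suc m} f with f Data.Fin.zero
... | none   = ⊕ᶠ (λ i → f (Data.Fin.suc i))
... | some I = I ⊕ ⊕ᶠ (λ i → f (Data.Fin.suc i))

record Graph (k : ℕ) : Set where
  field
    #N     : ℕ
    #E     : ℕ
    source : Fin #E → Fin #N
    target : Fin #E → Fin #N
    lab    : Fin #E → Fin k
    occur  : Fin #E → Interval
open Graph public

size : ∀ {k} → Graph k → ℕ
size G = #N G + #E G

IsSimple : ∀ {k} → Graph k → Set
IsSimple G =
    (∀ e → lo (occur G e) ≡ 1 × hi (occur G e) ≡ fin 1)
  × (∀ e e′ → source G e ≡ source G e′ → target G e ≡ target G e′
            → lab G e ≡ lab G e′ → e ≡ e′)

IsShape : ∀ {k} → Graph k → Set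
IsShape G = ∀ e → IsBasic (occur G e)

OutMap : ∀ {k} (G H : Graph k) → Fin (#N G) → Set
OutMap G H n = (e : Fin (#E G)) → source G e ≡ n → Fin (#E H)

preSum : ∀ {k} (G H : Graph k) (n : Fin (#N G)) → OutMap G H n → Fin (#E H) → Interval
preSum G H n λ′ f = ⊕ᶠ pick
  where
  pick : Fin (#E G) → Opt Interval
  pick e with source G e ≟ n
  ... | no _  = none
  ... | yes p with λ′ e p ≟ f
  ...   | yes _ = some (occur G e)
  ...   | no _  = none

IsSimulation : ∀ {k} (G H : Graph k) → (Fin (#N G) → Fin (#N H) → Set) → Set
IsSimulation G H R =
  ∀ n m → R n m →
  Σ (OutMap G H n) λ λ′ →
      (∀ e (p : source G e ≡ n) →
           source H (λ′ e p) ≡ m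
         × lab G e ≡ lab H (λ′ e p)
         × R (target G e) (target H (λ′ e p)))
    × (∀ f → source H f ≡ m → preSum G H n λ′ f ⊆I occur H f)

_≼_ : ∀ {k} → Graph k → Graph k → Set₁
G ≼ H = Σ (Fin (#N G) → Fin (#N H) → Set) λ R →
          IsSimulation G H R × (∀ n → ∃ λ m → R n m)

_∈L_ : ∀ {k} → Graph k → Graph k → Set₁
G ∈L H = IsSimple G × G ≼ H

_⊆L_ : ∀ {k} → Graph k → Graph k → Set₁
H ⊆L K = ∀ G → G ∈L H → G ∈L K

-- Polynomials with natural-number coefficients (coefficient list, lowest
-- degree first) and their evaluation

Poly : Set
Poly = List ℕ

eval : Poly → ℕ → ℕ
eval p x = foldr (λ c acc → c + x * acc) 0 p

module Submission where

-- The nodes of a graph that lie outside a type of K are found by refinement: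
-- start with no exclusions and exclude a node n from t once no admissible map of
-- its out-edges to those of t exists.  Call a pair (s , F) of a type s of H and a
-- set F of types of K refutable if some node conforms to s and is excluded from
-- every type in F.  If s has a refutable pair with F full, there is a
-- counterexample; refutability is a least fixed point over |N_H| 2^|N_K| pairs.
-- Each new pair is justified by a neighbourhood leading to older pairs, and at
-- most |E_K| + 1 edges over the same edge of H with the same exclusions matter.
-- Choosing one neighbourhood per pair gives an exponential graph, in which the
-- exclusions hold by induction on the round at which a pair was added.  Only
-- exclusion has to be certified, never membership in a type of K, so one choice
-- per pair serves all the nodes that share it.

open import Defs
open import Data.Nat using (ℕ; zero; suc; z≤n; s≤s; _+_; _*_; _^_; _≤_)
import Data.Nat as ℕ
import Data.Nat.Properties as ℕ
open import Data.Fin using (Fin; zero; suc; toℕ; fromℕ<; combine; remQuot; finToFun; funToFin)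
open import Data.Fin.Properties
  using (_≟_; any?; all?; pigeonhole; suc-injective; remQuot-combine; combine-remQuot; combine-injective;
         finToFun-funToFin; toℕ<n; toℕ-fromℕ<; toℕ-injective; <⇒≢)
open import Data.Fin.Subset using (Subset; _⊃_) renaming (_∈_ to _∈ₛ_)
open import Data.Fin.Subset.Induction using (⊃-wellFounded; Acc; acc)
open import Data.Vec using (tabulate)
open import Data.Vec.Properties using (lookup⇒[]=; []=⇒lookup; lookup∘tabulate)
open import Data.Product using (Σ; ∃; ∃₂; _×_; _,_; proj₁; proj₂; uncurry)
open import Data.Sum using (_⊎_; inj₁; inj₂)
open import Data.Unit using (⊤; tt)
open import Data.List using ([]; _∷_)
open import Data.Nat.Solver using (module +-*-Solver)
open import Data.Empty using (⊥)
open import Function using (_∘_; id)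
open import Relation.Nullary using (¬_; Dec; yes; no; does; contradiction)
open import Relation.Nullary.Decidable
  using (map′; _×-dec_; _⊎-dec_; _→-dec_; ¬?; dec-true; decidable-stable)
open import Relation.Unary using (Decidable)
open import Relation.Binary.PropositionalEquality
  using (_≡_; _≢_; refl; sym; trans; cong; cong₂; subst)
open import Relation.Binary.PropositionalEquality.WithK using (≡-irrelevant)

-- Finite sets: enumerations, coded subsets, stabilising chains

record Enumeration {M : ℕ} (P : Fin M → Set) : Set where
  field
    count    : ℕ
    at       : Fin count → Fin M
    sound    : ∀ i → P (at i)
    unique   : ∀ {i j} → at i ≡ at j → i ≡ j
    complete : ∀ x → P x → ∃ λ i → at i ≡ x
    bound    : count ≤ M
open Enumeration

enumerate : ∀ {M} {P : Fin M → Set} → Decidable P → Enumeration P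
enumerate {zero} P? = record
  { count = 0 ; at = λ () ; sound = λ () ; unique = λ { {()} } ; complete = λ () ; bound = z≤n }
enumerate {suc M} P? with P? zero | enumerate (P? ∘ suc)
... | no ¬p | E = record
  { count = count E
  ; at = suc ∘ at E
  ; sound = sound E
  ; unique = unique E ∘ suc-injective
  ; complete = λ { zero p → contradiction p ¬p
                 ; (suc x) p → let i , eq = complete E x p in i , cong suc eq }
  ; bound = ℕ.m≤n⇒m≤1+n (bound E) }
... | yes p₀ | E = record
  { count = suc (count E)
  ; at = λ { zero → zero ; (suc i) → suc (at E i) }
  ; sound = λ { zero → p₀ ; (suc i) → sound E i }
  ; unique = λ { {zero} {zero} _ → refl
               ; {suc _} {suc _} eq → cong suc (unique E (suc-injective eq)) }
  ; complete = λ { zero _ → zero , refl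
                 ; (suc x) p → let i , eq = complete E x p in suc i , cong suc eq }
  ; bound = s≤s (bound E) }

infix 4 _∈ˢ_ _∈ˢ?_

-- Subsets are coded as numbers below `2 ^ n`, so that families of them can be searched by `any?`
-- and counted.
_∈ˢ_ : ∀ {n} → Fin n → Fin (2 ^ n) → Set
_∈ˢ_ {n} x c = finToFun {2} {n} c x ≡ suc zero

_∈ˢ?_ : ∀ {n} (x : Fin n) (c : Fin (2 ^ n)) → Dec (x ∈ˢ c)
_∈ˢ?_ {n} x c = finToFun {2} {n} c x ≟ suc zero

module _ {n} {P : Fin n → Set} (P? : Decidable P) where

  private
    indicator : Fin n → Fin 2
    indicator x with P? x
    ... | yes _ = suc zero
    ... | no _  = zero

  toSet : Fin (2 ^ n)
  toSet = funToFin indicator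

  ∈-toSet⁺ : ∀ {x} → P x → x ∈ˢ toSet
  ∈-toSet⁺ {x} p = trans (finToFun-funToFin indicator x) lemma
    where
    lemma : indicator x ≡ suc zero
    lemma with P? x
    ... | yes _ = refl
    ... | no ¬p = contradiction p ¬p

  ∈-toSet⁻ : ∀ {x} → x ∈ˢ toSet → P x
  ∈-toSet⁻ {x} x∈ with P? x | trans (sym (finToFun-funToFin indicator x)) x∈
  ... | yes p | _ = p
  ... | no _  | ()

-- An increasing chain of decidable subsets of a finite set stabilises.
module _ {M} (P : ℕ → Fin M → Set) (P? : ∀ i → Decidable (P i))
         (increasing : ∀ {i x} → P i x → P (suc i) x) where

  private
    stage : ℕ → Subset M
    stage i = tabulate (does ∘ P? i)

    ∈-stage⁺ : ∀ {i x} → P i x → x ∈ₛ stage i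
    ∈-stage⁺ {i} {x} p = lookup⇒[]= x _ (trans (lookup∘tabulate _ x) (dec-true (P? i x) p))

    ∈-stage⁻ : ∀ {i x} → x ∈ₛ stage i → P i x
    ∈-stage⁻ {i} {x} x∈ with P? i x | trans (sym (lookup∘tabulate (does ∘ P? i) x)) ([]=⇒lookup x∈)
    ... | yes p | _ = p
    ... | no _  | ()

    search : ∀ i → Acc _⊃_ (stage i) → ∃ λ j → ∀ x → P (suc j) x → P j x
    search i (acc rs) with any? (λ x → P? (suc i) x ×-dec ¬? (P? i x))
    ... | yes (x , p , ¬p) =
          search (suc i) (rs ( (λ x∈ → ∈-stage⁺ (increasing (∈-stage⁻ x∈)))
                             , x , ∈-stage⁺ p , ¬p ∘ ∈-stage⁻ ))
    ... | no settled = i , λ x p → decidable-stable (P? i x) (λ ¬p → settled (x , p , ¬p))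

  stabilises : ∃ λ i → ∀ x → P (suc i) x → P i x
  stabilises = search 0 (⊃-wellFounded _)

-- Applied twice: to the refutable pairs, and to the excluded types of the nodes of a given graph.
stabilises₂ : ∀ {a b} (P : ℕ → Fin a → Fin b → Set) → (∀ i x y → Dec (P i x y)) →
              (∀ {i x y} → P i x y → P (suc i) x y) →
              ∃ λ i → ∀ x y → P (suc i) x y → P i x y
stabilises₂ {a} {b} P P? increasing with
  stabilises (λ i z → uncurry (P i) (remQuot {a} b z)) (λ i z → P? i _ _) increasing
... | i , stable = i , λ x y p → subst (uncurry (P i)) (remQuot-combine x y)
        (stable (combine x y) (subst (uncurry (P (suc i))) (sym (remQuot-combine x y)) p))

-- The simulation condition at a single node

-- The simulation condition at one node whose out-edges are the i with g i ≡ v.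
-- When those edges carry [1;1], inclusion of their ⊕-sum in a basic interval says
-- just that the fibre over f is inhabited (lo = 1) or has at most one element (hi = 1).
record Local {k} (X : Graph k) {q N} (g : Fin q → Fin N) (v : Fin N) (a : Fin q → Fin k)
             (Ok : Fin q → Fin (#N X) → Set) (m : Fin (#N X)) : Set where
  field
    φ      : ∀ i → g i ≡ v → Fin (#E X)
    source≡ : ∀ i p → source X (φ i p) ≡ m
    lab≡   : ∀ i p → a i ≡ lab X (φ i p)
    target-ok : ∀ i p → Ok i (target X (φ i p))
    lower  : ∀ f → source X f ≡ m → lo (occur X f) ≡ 1 → ∃₂ λ i p → φ i p ≡ f
    upper  : ∀ f → source X f ≡ m → hi (occur X f) ≡ fin 1 →
             ∀ i j p q → φ i p ≡ f → φ j q ≡ f → i ≡ j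
open Local

hi≡1? : ∀ I → Dec (hi I ≡ fin 1)
hi≡1? I with hi I
... | ∞ = no λ ()
... | fin n with n ℕ.≟ 1
...   | yes refl = yes refl
...   | no n≢1  = no λ { refl → n≢1 refl }

module _ {k} {X : Graph k} where

  φ-irrelevant : ∀ {q N} {g : Fin q → Fin N} {v a Ok m} (L : Local X g v a Ok m) {i j} (p : g i ≡ v) (p′ : g j ≡ v) →
                 i ≡ j → φ L i p ≡ φ L j p′
  φ-irrelevant L p p′ refl = cong (φ L _) (≡-irrelevant p p′)

  weaken : ∀ {q N} {g : Fin q → Fin N} {v a Ok Ok′ m} → (∀ i t → Ok i t → Ok′ i t) →
           Local X g v a Ok m → Local X g v a Ok′ m
  weaken h L = record
    { φ = φ L ; source≡ = source≡ L ; lab≡ = lab≡ L ; target-ok = λ i p → h i _ (target-ok L i p)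
    ; lower = lower L ; upper = upper L }

  -- `τ` is a bijection between active indices: surjectivity preserves lower bounds, injectivity
  -- upper bounds. This moves conditions between the slots of a plan and the edges of the graph
  -- built from it.
  pull : ∀ {q q′ N N′} {g : Fin q → Fin N} {g′ : Fin q′ → Fin N′} {v v′ a a′ Ok Ok′ m}
         (τ : ∀ i → g′ i ≡ v′ → Fin q) →
         (∀ i p → g (τ i p) ≡ v) →
         (∀ i p → a (τ i p) ≡ a′ i) →
         (∀ i p t → Ok (τ i p) t → Ok′ i t) →
         (∀ i j p p′ → τ i p ≡ τ j p′ → i ≡ j) →
         (∀ i → g i ≡ v → ∃₂ λ i′ p′ → τ i′ p′ ≡ i) →
         Local X g v a Ok m → Local X g′ v′ a′ Ok′ m
  pull τ active lbl ok injective surjective L = record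
    { φ = λ i p → φ L (τ i p) (active i p)
    ; source≡ = λ i p → source≡ L _ _
    ; lab≡ = λ i p → trans (sym (lbl i p)) (lab≡ L _ _)
    ; target-ok = λ i p → ok i p _ (target-ok L _ _)
    ; lower = λ f sf lf → let i , p , eq = lower L f sf lf
                              i′ , p′ , eq′ = surjective i p
                          in i′ , p′ , trans (φ-irrelevant L _ _ eq′) eq
    ; upper = λ f sf hf i j p q ei ej → injective i j p q (upper L f sf hf _ _ _ _ ei ej) }

-- A neighbourhood map is searched as a total function into Fin (suc #E),
-- where zero stands for "undefined".
module _ {k} (X : Graph k) {q N} (g : Fin q → Fin N) (v : Fin N) (a : Fin q → Fin k)
         {Ok : Fin q → Fin (#N X) → Set} (Ok? : ∀ i t → Dec (Ok i t)) (m : Fin (#N X)) where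

  private
    Edge : Fin q → Fin (#E X) → Set
    Edge i f = source X f ≡ m × a i ≡ lab X f × Ok i (target X f)

    Coded : (Fin q → Fin (suc (#E X))) → Set
    Coded ψ = (∀ i → g i ≡ v → ∃ λ f → ψ i ≡ suc f × Edge i f)
            × (∀ f → source X f ≡ m → lo (occur X f) ≡ 1 → ∃ λ i → g i ≡ v × ψ i ≡ suc f)
            × (∀ f → source X f ≡ m → hi (occur X f) ≡ fin 1 →
               ∀ i j → g i ≡ v → g j ≡ v → ψ i ≡ suc f → ψ j ≡ suc f → i ≡ j)

    coded? : ∀ ψ → Dec (Coded ψ)
    coded? ψ =
          all? (λ i → (g i ≟ v) →-dec any? λ f → (ψ i ≟ suc f) ×-dec
            ((source X f ≟ m) ×-dec ((a i ≟ lab X f) ×-dec Ok? i (target X f))))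
      ×-dec all? (λ f → (source X f ≟ m) →-dec ((lo (occur X f) ℕ.≟ 1) →-dec
              any? λ i → (g i ≟ v) ×-dec (ψ i ≟ suc f)))
      ×-dec all? (λ f → (source X f ≟ m) →-dec (hi≡1? (occur X f) →-dec
              all? λ i → all? λ j → (g i ≟ v) →-dec ((g j ≟ v) →-dec
                ((ψ i ≟ suc f) →-dec ((ψ j ≟ suc f) →-dec (i ≟ j))))))

    decode : ∀ {ψ} → Coded ψ → Local X g v a Ok m
    decode (def , low , up) = record
      { φ = λ i p → proj₁ (def i p)
      ; source≡ = λ i p → proj₁ (proj₂ (proj₂ (def i p)))
      ; lab≡ = λ i p → proj₁ (proj₂ (proj₂ (proj₂ (def i p))))
      ; target-ok = λ i p → proj₂ (proj₂ (proj₂ (proj₂ (def i p))))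
      ; lower = λ f sf lf → let i , p , eq = low f sf lf
                            in i , p , suc-injective (trans (sym (proj₁ (proj₂ (def i p)))) eq)
      ; upper = λ f sf hf i j p q ei ej → up f sf hf i j p q
                  (trans (proj₁ (proj₂ (def i p))) (cong suc ei))
                  (trans (proj₁ (proj₂ (def j q))) (cong suc ej)) }

    module _ (L : Local X g v a Ok m) where

      code : Fin q → Fin (suc (#E X))
      code i with g i ≟ v
      ... | yes p = suc (φ L i p)
      ... | no _  = zero

      code≡ : ∀ i p → code i ≡ suc (φ L i p)
      code≡ i p with g i ≟ v
      ... | yes p′ = cong suc (φ-irrelevant L p′ p refl)
      ... | no ¬p  = contradiction p ¬p

      encode : ∀ {ψ} → (∀ i → ψ i ≡ code i) → Coded ψ
      encode {ψ} eq =
          (λ i p → φ L i p , ψ≡ i p , source≡ L i p , lab≡ L i p , target-ok L i p)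
        , (λ f sf lf → let i , p , e = lower L f sf lf in i , p , trans (ψ≡ i p) (cong suc e))
        , (λ f sf hf i j p q ei ej → upper L f sf hf i j p q
             (suc-injective (trans (sym (ψ≡ i p)) ei)) (suc-injective (trans (sym (ψ≡ j q)) ej)))
        where
        ψ≡ : ∀ i p → ψ i ≡ suc (φ L i p)
        ψ≡ i p = trans (eq i) (code≡ i p)

  local? : Dec (Local X g v a Ok m)
  local? = map′ (λ (c , C) → decode C)
                (λ L → funToFin (code L) , encode L (finToFun-funToFin (code L)))
                (any? λ c → coded? (finToFun {suc (#E X)} {q} c))

-- Interval sums as edge counts

Unit : Opt Interval → Set
Unit none     = ⊤
Unit (some I) = lo I ≡ 1 × hi I ≡ fin 1

Present : Opt Interval → Set
Present o = ∃ λ I → o ≡ some I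

-- A sum of copies of [1;1] is the point interval at `total`. Basic intervals have only the bounds
-- 0, 1 and ∞, so `total` need only be compared with 0 and 1.
record Counted {m} (P : Fin m → Opt Interval) : Set where
  field
    total  : ℕ
    lo≡    : lo (⊕ᶠ P) ≡ total
    hi≡    : hi (⊕ᶠ P) ≡ fin total
    empty  : total ≡ 0 → ∀ i → ¬ Present (P i)
    inhabited : 1 ≤ total → ∃ λ i → Present (P i)
    single : total ≤ 1 → ∀ i j → Present (P i) → Present (P j) → i ≡ j
    single⁻ : (∀ i j → Present (P i) → Present (P j) → i ≡ j) → total ≤ 1
open Counted

⊕ᶠ-none : ∀ {m} (P : Fin (suc m) → Opt Interval) → P zero ≡ none → ⊕ᶠ P ≡ ⊕ᶠ (P ∘ suc)
⊕ᶠ-none P eq with P zero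
⊕ᶠ-none P refl | none = refl

⊕ᶠ-some : ∀ {m} (P : Fin (suc m) → Opt Interval) {I} → P zero ≡ some I → ⊕ᶠ P ≡ I ⊕ ⊕ᶠ (P ∘ suc)
⊕ᶠ-some P eq with P zero
⊕ᶠ-some P refl | some I = refl

count-⊕ᶠ : ∀ {m} (P : Fin m → Opt Interval) → (∀ i → Unit (P i)) → Counted P
count-⊕ᶠ {zero} P u = record
  { total = 0 ; lo≡ = refl ; hi≡ = refl ; empty = λ _ () ; inhabited = λ () ; single = λ _ () ; single⁻ = λ _ → z≤n }
count-⊕ᶠ {suc m} P u with P zero in eq | u zero | count-⊕ᶠ (P ∘ suc) (u ∘ suc)
... | none | _ | C = record
  { total = total C ; lo≡ = trans (cong lo (⊕ᶠ-none P eq)) (lo≡ C) ; hi≡ = trans (cong hi (⊕ᶠ-none P eq)) (hi≡ C)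
  ; empty = λ { z zero p → absent p ; z (suc i) p → empty C z i p }
  ; inhabited = λ l → let i , p = inhabited C l in suc i , p
  ; single = λ { l zero _ p _ → contradiction p absent
               ; l (suc _) zero _ p → contradiction p absent
               ; l (suc i) (suc j) p q → cong suc (single C l i j p q) }
  ; single⁻ = λ h → single⁻ C (λ i j p q → suc-injective (h (suc i) (suc j) p q)) }
  where
  absent : ¬ Present (P zero)
  absent (I , e) with trans (sym eq) e
  ... | ()
... | some I | l1 , h1 | C = record
  { total = suc (total C)
  ; lo≡ = trans (cong lo (⊕ᶠ-some P eq)) (cong₂ _+_ l1 (lo≡ C))
  ; hi≡ = trans (cong hi (⊕ᶠ-some P eq)) (cong₂ _+∞_ h1 (hi≡ C))
  ; empty = λ ()
  ; inhabited = λ _ → zero , I , eq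
  ; single = λ { _ zero zero _ _ → refl
               ; (s≤s l) zero (suc j) _ q → contradiction q (empty C (ℕ.n≤0⇒n≡0 l) j)
               ; (s≤s l) (suc i) _ p _ → contradiction p (empty C (ℕ.n≤0⇒n≡0 l) i) }
  ; single⁻ = λ h → s≤s (none-left h) }
  where
  none-left : (∀ i j → Present (P i) → Present (P j) → i ≡ j) → total C ≤ 0
  none-left h with total C in t
  ... | zero = z≤n
  ... | suc n with inhabited C (subst (1 ≤_) (sym t) (s≤s z≤n))
  ...   | i , p with h zero (suc i) (I , eq) p
  ...     | ()

module _ {k} (G X : Graph k) (n : Fin (#N G)) (λ′ : OutMap G X n) (f : Fin (#E X)) where

  private
    -- The summand of preSum is local to Defs; unification recovers it.
    summand : Σ (Fin (#E G) → Opt Interval) λ P → preSum G X n λ′ f ≡ ⊕ᶠ P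
    summand = _ , refl

    present⁻ : ∀ e → Present (proj₁ summand e) → Σ (source G e ≡ n) λ p → λ′ e p ≡ f
    present⁻ e (I , eq) with source G e ≟ n
    ... | yes p with λ′ e p ≟ f
    ...   | yes q = p , q
    present⁻ e (I , ()) | yes p | no _
    present⁻ e (I , ()) | no _

    present⁺ : ∀ e p → λ′ e p ≡ f → Present (proj₁ summand e)
    present⁺ e p q with source G e ≟ n
    ... | no ¬p = contradiction p ¬p
    ... | yes p′ with λ′ e p′ ≟ f
    ...   | yes _ = _ , refl
    ...   | no ¬q = contradiction (trans (cong (λ′ e) (≡-irrelevant p′ p)) q) ¬q

    unit : (∀ e → lo (occur G e) ≡ 1 × hi (occur G e) ≡ fin 1) → ∀ e → Unit (proj₁ summand e)
    unit ones e with source G e ≟ n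
    ... | no _ = tt
    ... | yes p with λ′ e p ≟ f
    ...   | yes _ = ones e
    ...   | no _ = tt

    Count : (∀ e → lo (occur G e) ≡ 1 × hi (occur G e) ≡ fin 1) → Counted (proj₁ summand)
    Count ones = count-⊕ᶠ (proj₁ summand) (unit ones)

  AtLeastOnce AtMostOnce : Set
  AtLeastOnce = ∃₂ λ e p → λ′ e p ≡ f
  AtMostOnce = ∀ i j p q → λ′ i p ≡ f → λ′ j q ≡ f → i ≡ j

  module _ (ones : ∀ e → lo (occur G e) ≡ 1 × hi (occur G e) ≡ fin 1) where

    private
      C = Count ones

      -- An inclusion of the sum is evaluated at this one point, where it bounds the number of edges
      -- over `f`.
      total∈ : total C ∈I preSum G X n λ′ f
      total∈ = ℕ.≤-reflexive (lo≡ C) , subst (total C ≤∞_) (sym (hi≡ C)) ℕ.≤-refl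

    ⊆I⇒lower : preSum G X n λ′ f ⊆I occur X f → lo (occur X f) ≡ 1 → AtLeastOnce
    ⊆I⇒lower sub lo1 with inhabited C (subst (_≤ total C) lo1 (proj₁ (sub (total C) total∈)))
    ... | e , pr = e , present⁻ e pr

    ⊆I⇒upper : preSum G X n λ′ f ⊆I occur X f → hi (occur X f) ≡ fin 1 → AtMostOnce
    ⊆I⇒upper sub hi1 i j p q ei ej =
      single C (subst (total C ≤∞_) hi1 (proj₂ (sub (total C) total∈))) i j (present⁺ i p ei) (present⁺ j q ej)

    -- The bounds 0 and ∞ hold for free; in a basic interval only a bound 1 is a constraint.
    ⊆I-intro : IsBasic (occur X f) → (lo (occur X f) ≡ 1 → AtLeastOnce) →
               (hi (occur X f) ≡ fin 1 → AtMostOnce) → preSum G X n λ′ f ⊆I occur X f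
    -- The sum is a point interval, so `x` can only be `total C`.
    ⊆I-intro basic low up x (lx , xh) with ℕ.≤-antisym (subst (_≤ x) (lo≡ C) lx) (subst (x ≤∞_) (hi≡ C) xh)
    ... | refl = lower-ok basic , upper-ok basic
      where
      1≤total : lo (occur X f) ≡ 1 → 1 ≤ total C
      1≤total l with total C in t
      ... | suc _ = s≤s z≤n
      ... | zero = let e , p , q = low l in contradiction (present⁺ e p q) (empty C t e)

      lower-ok : IsBasic (occur X f) → lo (occur X f) ≤ total C
      lower-ok b with lo (occur X f) ℕ.≟ 1
      ... | yes l = subst (_≤ total C) (sym l) (1≤total l)
      lower-ok (inj₁ (l , _)) | no ¬l = contradiction l ¬l
      lower-ok (inj₂ (inj₁ (l , _))) | no _ = subst (_≤ total C) (sym l) z≤n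
      lower-ok (inj₂ (inj₂ (inj₁ (l , _)))) | no ¬l = contradiction l ¬l
      lower-ok (inj₂ (inj₂ (inj₂ (l , _)))) | no _ = subst (_≤ total C) (sym l) z≤n

      total≤1 : hi (occur X f) ≡ fin 1 → total C ≤∞ hi (occur X f)
      total≤1 h = subst (total C ≤∞_) (sym h) (single⁻ C λ i j pi pj →
        let p , ei = present⁻ i pi ; q , ej = present⁻ j pj in up h i j p q ei ej)

      upper-ok : IsBasic (occur X f) → total C ≤∞ hi (occur X f)
      upper-ok (inj₁ (_ , h)) = total≤1 h
      upper-ok (inj₂ (inj₁ (_ , h))) = total≤1 h
      upper-ok (inj₂ (inj₂ (inj₁ (_ , h)))) = subst (total C ≤∞_) (sym h) tt
      upper-ok (inj₂ (inj₂ (inj₂ (_ , h)))) = subst (total C ≤∞_) (sym h) tt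

-- Simulations in terms of local conditions

module _ {k} (G X : Graph k) (ones : ∀ e → lo (occur G e) ≡ 1 × hi (occur G e) ≡ fin 1)
         (R : Fin (#N G) → Fin (#N X) → Set) where

  simulation⇒local : IsSimulation G X R → ∀ n m → R n m →
                     Local X (source G) n (lab G) (λ e → R (target G e)) m
  simulation⇒local sim n m r with sim n m r
  ... | λ′ , valid , sums = record
    { φ = λ′
    ; source≡ = λ e p → proj₁ (valid e p)
    ; lab≡ = λ e p → proj₁ (proj₂ (valid e p))
    ; target-ok = λ e p → proj₂ (proj₂ (valid e p))
    ; lower = λ f sf → ⊆I⇒lower G X n λ′ f ones (sums f sf)
    ; upper = λ f sf → ⊆I⇒upper G X n λ′ f ones (sums f sf) }

  local⇒simulation : IsShape X →
                     (∀ n m → R n m → Local X (source G) n (lab G) (λ e → R (target G e)) m) →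
                     IsSimulation G X R
  local⇒simulation shape loc n m r =
      φ L
    , (λ e p → source≡ L e p , lab≡ L e p , target-ok L e p)
    , λ f sf → ⊆I-intro G X n (φ L) f ones (shape f) (lower L f sf) (upper L f sf)
    where L = loc n m r

-- Refutable pairs and the neighbourhoods that justify them

module Refutation {k} (H K : Graph k) where

  Kinds Colours Multiplicity Slots : ℕ
  Kinds = #N H * 2 ^ #N K
  Colours = #E H * 2 ^ #N K
  -- One more than #E K, so that a full colour class forces two edges onto the same edge of K.
  Multiplicity = suc (#E K)
  Slots = Colours * Multiplicity

  -- A slot is an edge of H, a set of types of K refuted at the target, and a copy
  -- number; a subset of the slots describes the out-edges of a node.
  Slot Failing : Set
  Slot = Fin Slots
  Failing = Fin (2 ^ #N K)

  colour : Slot → Fin Colours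
  colour σ = proj₁ (remQuot Multiplicity σ)

  copy : Slot → Fin Multiplicity
  copy σ = proj₂ (remQuot {Colours} Multiplicity σ)

  edgeOf : Slot → Fin (#E H)
  edgeOf σ = proj₁ (remQuot (2 ^ #N K) (colour σ))

  failsOf : Slot → Failing
  failsOf σ = proj₂ (remQuot {#E H} (2 ^ #N K) (colour σ))

  labelOf : Slot → Fin k
  labelOf = lab H ∘ edgeOf

  slot-ext : ∀ {σ τ} → colour σ ≡ colour τ → copy σ ≡ copy τ → σ ≡ τ
  slot-ext {σ} {τ} c j = trans (sym (combine-remQuot {Colours} Multiplicity σ))
    (trans (cong₂ combine c j) (combine-remQuot {Colours} Multiplicity τ))

  colour-ext : ∀ {σ τ} → edgeOf σ ≡ edgeOf τ → failsOf σ ≡ failsOf τ → colour σ ≡ colour τ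
  colour-ext {σ} {τ} h F = trans (sym (combine-remQuot {#E H} (2 ^ #N K) (colour σ)))
    (trans (cong₂ combine h F) (combine-remQuot {#E H} (2 ^ #N K) (colour τ)))

  kind-combine : ∀ h F j → let σ = combine (combine h F) j in (edgeOf σ , failsOf σ) ≡ (h , F)
  kind-combine h F j = trans
    (cong (λ z → remQuot {#E H} (2 ^ #N K) (proj₁ z)) (remQuot-combine {n = Colours} (combine h F) j))
    (remQuot-combine h F)

  edgeOf-combine : ∀ h F j → edgeOf (combine (combine h F) j) ≡ h
  edgeOf-combine h F j = cong proj₁ (kind-combine h F j)

  failsOf-combine : ∀ h F j → failsOf (combine (combine h F) j) ≡ F
  failsOf-combine h F j = cong proj₂ (kind-combine h F j)

  members : Fin (2 ^ Slots) → Slot → Fin 2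
  members w σ = finToFun {2} {Slots} w σ

  LocalH : Fin (2 ^ Slots) → Fin (#N H) → Set
  LocalH w = Local H (members w) (suc zero) labelOf (λ σ s → s ≡ target H (edgeOf σ))

  -- Each target is credited with every type outside its refuted set. If even this generous
  -- condition fails, the type is excluded as soon as the refuted sets are correct.
  LocalK : Fin (2 ^ Slots) → Fin (#N K) → Set
  LocalK w = Local K (members w) (suc zero) labelOf (λ σ t → ¬ t ∈ˢ failsOf σ)

  localK? : ∀ w t → Dec (LocalK w t)
  localK? w t = local? K (members w) (suc zero) labelOf (λ σ t′ → ¬? (t′ ∈ˢ? failsOf σ)) t

  Witness : (Fin (#N H) → Failing → Set) → Fin (#N H) → Failing → Fin (2 ^ Slots) → Set
  Witness A s F w = (∀ σ → σ ∈ˢ w → A (target H (edgeOf σ)) (failsOf σ))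
                  × LocalH w s
                  × (∀ (t : Fin (#N K)) → t ∈ˢ F → ¬ LocalK w t)

  Derivable : (Fin (#N H) → Failing → Set) → Fin (#N H) → Failing → Set
  Derivable A s F = ∃ (Witness A s F)

  derivable? : ∀ {A} → (∀ s F → Dec (A s F)) → ∀ s F → Dec (Derivable A s F)
  derivable? A? s F = any? λ w →
          all? (λ σ → (σ ∈ˢ? w) →-dec A? _ _)
    ×-dec local? H (members w) (suc zero) labelOf (λ σ s′ → s′ ≟ target H (edgeOf σ)) s
    ×-dec all? (λ (t : Fin (#N K)) → (t ∈ˢ? F) →-dec ¬? (localK? w t))

  -- Meaning: some simple graph has a node that conforms to s but is excluded from
  -- every type in F within i rounds of the refinement computing the largest simulation.
  Refutable : ℕ → Fin (#N H) → Failing → Set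
  Refutable zero s F = ∀ (t : Fin (#N K)) → ¬ t ∈ˢ F
  Refutable (suc i) s F = Refutable i s F ⊎ Derivable (Refutable i) s F

  refutable? : ∀ i s F → Dec (Refutable i s F)
  refutable? zero s F = all? λ (t : Fin (#N K)) → ¬? (t ∈ˢ? F)
  refutable? (suc i) s F = refutable? i s F ⊎-dec derivable? (refutable? i) s F

  ∅ : Failing
  ∅ = toSet {#N K} (λ t → no (λ (x : ⊥) → x))

  module _ (s : Fin (#N H)) where

    IsDefault : Slot → Set
    IsDefault σ = source H (edgeOf σ) ≡ s × failsOf σ ≡ ∅ × copy σ ≡ zero

    isDefault? : Decidable IsDefault
    isDefault? σ = (source H (edgeOf σ) ≟ s) ×-dec ((failsOf σ ≟ ∅) ×-dec (copy σ ≟ zero))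

    default : Fin (2 ^ Slots)
    default = toSet isDefault?

    -- One edge over each out-edge of `s` meets lower and upper bounds alike. Nodes that have
    -- nothing to certify use this neighbourhood and so still conform to `H`.
    default-local : LocalH default s
    default-local = record
      { φ = λ σ _ → edgeOf σ
      ; source≡ = λ σ p → proj₁ (isDef σ p)
      ; lab≡ = λ σ _ → refl
      ; target-ok = λ σ _ → refl
      ; lower = λ h sh _ → first h , ∈-toSet⁺ isDefault?
          ( trans (cong (source H) (edgeOf-combine h ∅ zero)) sh , failsOf-combine h ∅ zero
          , cong proj₂ (remQuot-combine {n = Colours} (combine h ∅) zero)) , edgeOf-combine h ∅ zero
      ; upper = λ h _ _ σ τ p q eσ eτ →
          let _ , Fσ , jσ = isDef σ p ; _ , Fτ , jτ = isDef τ q in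
          slot-ext (colour-ext {σ} {τ} (trans eσ (sym eτ)) (trans Fσ (sym Fτ))) (trans jσ (sym jτ)) }
      where
      isDef : ∀ σ → σ ∈ˢ default → IsDefault σ
      isDef σ p = ∈-toSet⁻ isDefault? p
      first : Fin (#E H) → Slot
      first h = combine (combine h ∅) zero

  -- A neighbourhood is chosen in the round in which its pair first becomes derivable, and then
  -- kept, so that its slots lead to pairs of earlier rounds and justification is never circular.
  plan : ℕ → ∀ s → Failing → ∃ λ w → LocalH w s
  plan zero s F = default s , default-local s
  plan (suc i) s F with refutable? i s F | derivable? (refutable? i) s F
  ... | yes _ | _                       = plan i s F
  ... | no _  | yes (w , _ , local , _) = w , local
  ... | no _  | no _                    = default s , default-local s

  -- `plan` looks back before it searches, so a choice is never revised.
  plan-stable : ∀ i j {s F} → Refutable i s F → i ℕ.≤′ j → plan j s F ≡ plan i s F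
  plan-stable i .i r ℕ.≤′-refl = refl
  plan-stable i (suc j) {s} {F} r (ℕ.≤′-step i≤j) with refutable? j s F | derivable? (refutable? j) s F
  ... | yes _ | _ = plan-stable i j r i≤j
  ... | no ¬r | _ = contradiction (later i≤j) ¬r
    where
    later : ∀ {j} → i ℕ.≤′ j → Refutable j s F
    later ℕ.≤′-refl = r
    later (ℕ.≤′-step l) = inj₁ (later l)

  plan-witness : ∀ i {s F} → ¬ Refutable i s F → Derivable (Refutable i) s F →
                 Witness (Refutable i) s F (proj₁ (plan (suc i) s F))
  plan-witness i {s} {F} ¬r d with refutable? i s F | derivable? (refutable? i) s F
  ... | yes r | _           = contradiction r ¬r
  ... | no _  | yes (_ , W) = W
  ... | no _  | no ¬d       = contradiction d ¬d

  -- The exponential counterexample graph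

  -- The copy number c of a node (s , F , c) is zero for a root and otherwise the slot
  -- through which the node is reached, so that parallel edges get distinct targets.
  module Counterexample (depth : ℕ) where

    Nodes Candidates : ℕ
    Nodes = Kinds * suc Slots
    Candidates = Nodes * Slots

    node : Fin (#N H) → Failing → Fin (suc Slots) → Fin Nodes
    node s F c = combine (combine s F) c

    typeOf : Fin Nodes → Fin (#N H)
    typeOf x = proj₁ (remQuot (2 ^ #N K) (proj₁ (remQuot {Kinds} (suc Slots) x)))

    refutes : Fin Nodes → Failing
    refutes x = proj₂ (remQuot {#N H} (2 ^ #N K) (proj₁ (remQuot {Kinds} (suc Slots) x)))

    node-kind : ∀ s F c → (typeOf (node s F c) , refutes (node s F c)) ≡ (s , F)
    node-kind s F c = trans
      (cong (λ z → remQuot {#N H} (2 ^ #N K) (proj₁ z)) (remQuot-combine {n = Kinds} (combine s F) c))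
      (remQuot-combine s F)

    slots : Fin Nodes → Fin (2 ^ Slots)
    slots x = proj₁ (plan depth (typeOf x) (refutes x))

    origin : Fin Candidates → Fin Nodes
    origin z = proj₁ (remQuot Slots z)

    slotOf : Fin Candidates → Slot
    slotOf z = proj₂ (remQuot {Nodes} Slots z)

    child : Slot → Fin Nodes
    child σ = node (target H (edgeOf σ)) (failsOf σ) (suc σ)

    edges : Enumeration (λ z → slotOf z ∈ˢ slots (origin z))
    edges = enumerate (λ z → slotOf z ∈ˢ? slots (origin z))

    graph : Graph k
    graph = record
      { #N = Nodes
      ; #E = count edges
      ; source = origin ∘ at edges
      ; target = child ∘ slotOf ∘ at edges
      ; lab = labelOf ∘ slotOf ∘ at edges
      ; occur = λ _ → interval 1 (fin 1) ℕ.≤-refl }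

    edge-ext : ∀ e e′ → source graph e ≡ source graph e′ →
               slotOf (at edges e) ≡ slotOf (at edges e′) → e ≡ e′
    edge-ext e e′ x σ = unique edges
      (trans (sym (combine-remQuot {Nodes} Slots _)) (trans (cong₂ combine x σ) (combine-remQuot {Nodes} Slots _)))

    simple : IsSimple graph
    simple = (λ _ → refl , refl) , λ e e′ x y _ →
      -- The copy number of a target is `suc` of the slot, so equal targets give equal slots.
      edge-ext e e′ x (suc-injective (proj₂ (combine-injective {Kinds} _ _ _ _ y)))

    edgeAt : ∀ x σ → σ ∈ˢ slots x → ∃ λ e → source graph e ≡ x × slotOf (at edges e) ≡ σ
    edgeAt x σ σ∈ = e , cong proj₁ decoded , cong proj₂ decoded
      where
      split : remQuot Slots (combine x σ) ≡ (x , σ)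
      split = remQuot-combine x σ
      found : ∃ λ e → at edges e ≡ combine x σ
      found = complete edges (combine x σ)
        (subst (λ (x , σ) → σ ∈ˢ slots x) (sym split) σ∈)
      e = proj₁ found
      decoded : remQuot Slots (at edges e) ≡ (x , σ)
      decoded = trans (cong (remQuot Slots) (proj₂ found)) split

    slot∈ : ∀ x e → source graph e ≡ x → slotOf (at edges e) ∈ˢ slots x
    slot∈ x e refl = sound edges e

    -- Every plan comes with a proof that it conforms to its type, and the out-edges of a node
    -- correspond to the slots of its plan.
    ≼H : IsShape H → graph ≼ H
    ≼H shape = (λ x s → s ≡ typeOf x)
      , local⇒simulation graph H (λ _ → refl , refl) _ shape (λ { x _ refl →
          pull (λ e _ → slotOf (at edges e)) (slot∈ x) (λ _ _ → refl)
               (λ e _ t eq → trans eq (sym (cong proj₁ (node-kind _ _ _))))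
               (λ e e′ p p′ → edge-ext e e′ (trans p (sym p′)))
               (λ σ σ∈ → let e , p , eq = edgeAt x σ σ∈ in e , p , eq)
               (proj₂ (plan depth (typeOf x) (refutes x))) })
      , λ x → typeOf x , refl

    weaken-≤′ : ∀ {i j} → suc i ℕ.≤′ j → i ℕ.≤′ j
    weaken-≤′ = ℕ.≤⇒≤′ ∘ ℕ.<⇒≤ ∘ ℕ.≤′⇒≤

    -- Induction on the round. The slots of the plan lead to pairs of earlier rounds, so `R` relates
    -- their targets only to types outside the refuted sets. The local map of `R` at `x` would then
    -- be a `LocalK`, which the witness rules out.
    refuted : ∀ {R} → IsSimulation graph K R → ∀ i → i ℕ.≤′ depth → ∀ x {t} →
              Refutable i (typeOf x) (refutes x) → R x t → ¬ t ∈ˢ refutes x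
    refuted sim zero _ x {t} r _ = r t
    refuted sim (suc i) i<d x (inj₁ r) = refuted sim i (weaken-≤′ i<d) x r
    refuted {R} sim (suc i) i<d x {t} (inj₂ d) Rxt t∈ with refutable? i (typeOf x) (refutes x)
    ... | yes r = refuted sim i (weaken-≤′ i<d) x r Rxt t∈
    ... | no ¬r = W .proj₂ .proj₂ t t∈
          (pull (λ σ σ∈ → proj₁ (edgeAt x σ σ∈))
                (λ σ σ∈ → proj₁ (proj₂ (edgeAt x σ σ∈)))
                (λ σ σ∈ → cong labelOf (slot≡ σ σ∈))
                (λ σ σ∈ t′ Rt′ t′∈ → refuted sim i (weaken-≤′ i<d) (target graph (proj₁ (edgeAt x σ σ∈)))
                   (subst (uncurry (Refutable i)) (sym (kind σ σ∈)) (W .proj₁ σ σ∈)) Rt′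
                   (subst (t′ ∈ˢ_) (sym (cong proj₂ (kind σ σ∈))) t′∈))
                (λ σ τ p q eq → trans (sym (slot≡ σ p)) (trans (cong (slotOf ∘ at edges) eq) (slot≡ τ q)))
                (λ e p → let σ∈ = slot∈ x e p ; e′ , p′ , eq = edgeAt x _ σ∈ in
                         _ , σ∈ , edge-ext e′ e (trans p′ (sym p)) eq)
                (simulation⇒local graph K (λ _ → refl , refl) R sim x t Rxt))
      where
      -- The graph uses the plan of round `depth`; the pair is refutable from round `suc i` on, so
      -- this is still the plan made then.
      W : Witness (Refutable i) (typeOf x) (refutes x) (slots x)
      W = subst (Witness (Refutable i) _ _) (cong proj₁ (sym (plan-stable (suc i) depth (inj₂ d) i<d)))
            (plan-witness i ¬r d)
      slot≡ : ∀ σ σ∈ → slotOf (at edges (proj₁ (edgeAt x σ σ∈))) ≡ σ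
      slot≡ σ σ∈ = proj₂ (proj₂ (edgeAt x σ σ∈))
      kind : ∀ σ σ∈ → let y = target graph (proj₁ (edgeAt x σ σ∈)) in
             (typeOf y , refutes y) ≡ (target H (edgeOf σ) , failsOf σ)
      kind σ σ∈ = trans (node-kind _ _ _) (cong (λ τ → target H (edgeOf τ) , failsOf τ) (slot≡ σ σ∈))

    ⋠K : ∀ {s F} → Refutable depth s F → (∀ (t : Fin (#N K)) → t ∈ˢ F) → ¬ graph ≼ K
    ⋠K {s} {F} r full (R , sim , total) =
      -- An embedding relates the root to some type, but the full set excludes them all.
      let x = node s F zero
          kind = node-kind s F zero
          t , Rxt = total x
      in refuted sim depth ℕ.≤′-refl x (subst (uncurry (Refutable depth)) (sym kind) r) Rxt
           (subst (t ∈ˢ_) (sym (cong proj₂ kind)) (full t))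

  -- Refinement in an arbitrary graph of L(H)

  module _ (G : Graph k) where

    LocalIn : (Fin (#N G) → Failing) → Fin (#N G) → Fin (#N K) → Set
    LocalIn F n = Local K (source G) n (lab G) (λ e t → ¬ t ∈ˢ F (target G e))

    localIn? : ∀ F n t → Dec (LocalIn F n t)
    localIn? F n = local? K (source G) n (lab G) (λ e t → ¬? (t ∈ˢ? F (target G e)))

    step : (Fin (#N G) → Failing) → Fin (#N G) → Failing
    step F n = toSet {#N K} (λ t → ¬? (localIn? F n t))

    -- Thinning the out-edges of a node to slots

    module Selection (F : Fin (#N G) → Failing) (n : Fin (#N G)) (s : Fin (#N H))
                     {R : Fin (#N G) → Fin (#N H) → Set}
                     (L : Local H (source G) n (lab G) (λ e → R (target G e)) s) where

      -- Edges of one colour share their label and the exclusions at their targets, so maps to `K`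
      -- cannot tell them apart.
      HasColour : Fin Colours → Fin (#E G) → Set
      HasColour c e = Σ (source G e ≡ n) λ p → combine (φ L e p) (F (target G e)) ≡ c

      hasColour? : ∀ c e → Dec (HasColour c e)
      hasColour? c e with source G e ≟ n
      ... | no ¬p = no (¬p ∘ proj₁)
      ... | yes p = map′ (p ,_) (λ (p′ , eq) → trans (cong (λ h → combine h _) (φ-irrelevant L p p′ refl)) eq)
                         (combine (φ L e p) (F (target G e)) ≟ c)

      class : ∀ c → Enumeration (HasColour c)
      class c = enumerate (hasColour? c)

      Nth : Fin Colours → Fin Multiplicity → Fin (#E G) → Set
      Nth c j e = ∃ λ i → toℕ i ≡ toℕ j × at (class c) i ≡ e

      -- Only the first Multiplicity edges of each colour are put into slots.
      Fills : Slot → Fin (#E G) → Set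
      Fills σ = uncurry Nth (remQuot {Colours} Multiplicity σ)

      fills? : ∀ σ e → Dec (Fills σ e)
      fills? σ e = any? λ i → (toℕ i ℕ.≟ toℕ (copy σ)) ×-dec (at (class (colour σ)) i ≟ e)

      filled? : ∀ σ → Dec (∃ (Fills σ))
      filled? σ = any? (fills? σ)

      selection : Fin (2 ^ Slots)
      selection = toSet filled?

      Fills⇒HasColour : ∀ {σ e} → Fills σ e → HasColour (colour σ) e
      Fills⇒HasColour {σ} (i , _ , refl) = sound (class (colour σ)) i

      decompose : ∀ {σ e} → Fills σ e → Σ (source G e ≡ n) λ p → φ L e p ≡ edgeOf σ × F (target G e) ≡ failsOf σ
      decompose {σ} fill with Fills⇒HasColour {σ} fill
      ... | p , eq = p , cong proj₁ split , cong proj₂ split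
        where split = trans (sym (remQuot-combine {#E H} _ _)) (cong (remQuot (2 ^ #N K)) eq)

      -- An edge has one colour and one position in the enumeration of its class.
      Fills-injective : ∀ {σ τ e} → Fills σ e → Fills τ e → σ ≡ τ
      Fills-injective {σ} {τ} {e} fσ fτ = slot-ext same-colour (toℕ-injective (same-copy same-colour fσ fτ))
        where
        same-colour : colour σ ≡ colour τ
        same-colour with Fills⇒HasColour {σ} fσ | Fills⇒HasColour {τ} fτ
        ... | p , eq | p′ , eq′ =
          trans (sym eq) (trans (cong (λ h → combine h _) (φ-irrelevant L p p′ refl)) eq′)
        same-copy : ∀ {c c′ j j′} → c ≡ c′ → Nth c j e → Nth c′ j′ e → toℕ j ≡ toℕ j′
        same-copy refl (i , ij , at-i) (i′ , ij′ , at-i′) =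
          trans (sym ij) (trans (cong toℕ (unique (class _) (trans at-i (sym at-i′)))) ij′)

      Fills-functional : ∀ {σ e e′} → Fills σ e → Fills σ e′ → e ≡ e′
      Fills-functional {σ} (i , ij , at-i) (i′ , ij′ , at-i′) =
        trans (sym at-i) (trans (cong (at (class (colour σ))) (toℕ-injective (trans ij (sym ij′)))) at-i′)

      -- An edge without a slot has at least `Multiplicity` predecessors in its class, and these
      -- fill every slot of the colour.
      saturated : ∀ c {e} → HasColour c e →
                  (∃ λ σ → Fills σ e) ⊎ (∀ (j : Fin Multiplicity) → combine c j ∈ˢ selection)
      saturated c {e} h with complete (class c) e h
      ... | i , at-i with toℕ i ℕ.<? Multiplicity
      ...   | yes i<M = inj₁ (combine c (fromℕ< i<M) , subst (λ (c , j) → Nth c j e) (sym (remQuot-combine c _))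
                          (i , sym (toℕ-fromℕ< i<M) , at-i))
      ...   | no i≮M = inj₂ λ j →
        let j<count = ℕ.<-trans (toℕ<n j) (ℕ.≤-<-trans (ℕ.≮⇒≥ i≮M) (toℕ<n i))
            e′ = at (class c) (fromℕ< j<count) in
        ∈-toSet⁺ filled? (e′ , subst (λ (c′ , j′) → Nth c′ j′ e′) (sym (remQuot-combine c j))
          (fromℕ< j<count , toℕ-fromℕ< j<count , refl))

      filler : ∀ {σ} → σ ∈ˢ selection → ∃ (Fills σ)
      filler = ∈-toSet⁻ filled?

      -- Thinning keeps an edge of every colour that occurs, which preserves lower bounds; no edge
      -- fills two slots, which preserves upper bounds.
      selection-localH : LocalH selection s
      selection-localH = record
        { φ = λ σ _ → edgeOf σ
        ; source≡ = λ σ σ∈ → let e , f = filler σ∈ ; p , eq , _ = decompose {σ} f in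
            trans (cong (source H) (sym eq)) (source≡ L e p)
        ; lab≡ = λ _ _ → refl
        ; target-ok = λ _ _ → refl
        ; lower = λ h sh lh → covered h (lower L h sh lh)
        ; upper = λ h sh hh σ τ σ∈ τ∈ hσ hτ →
            let e , f = filler σ∈ ; p , eq , _ = decompose {σ} f
                e′ , f′ = filler τ∈ ; p′ , eq′ , _ = decompose {τ} f′
                e≡e′ = upper L h sh hh e e′ p p′ (trans eq hσ) (trans eq′ hτ)
            in Fills-injective f (subst (Fills τ) (sym e≡e′) f′) }
        where
        covered : ∀ h → (∃₂ λ e p → φ L e p ≡ h) → ∃₂ λ σ (_ : σ ∈ˢ selection) → edgeOf σ ≡ h
        covered h (e , p , eq) with saturated _ (p , refl)
        ... | inj₁ (σ , f) = σ , ∈-toSet⁺ filled? (e , f) , (let p′ , eq′ , _ = decompose {σ} f in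
                trans (sym eq′) (trans (φ-irrelevant L p′ p refl) eq))
        -- All slots of the colour are filled, so copy `zero` will do.
        ... | inj₂ all∈ = _ , all∈ zero , trans (edgeOf-combine (φ L e p) (F (target G e)) zero) eq

      -- An edge without a slot has a colour whose slots are all filled; two of them
      -- go to the same edge of K, which can then take the extra edge as well.
      module Extend {t} (M : LocalK selection t) where

        -- `origin` records why upper bounds survive: the image comes from a slot of the edge, or
        -- its interval does not end at 1.
        record Image (e : Fin (#E G)) : Set where
          field
            image   : Fin (#E K)
            from-t  : source K image ≡ t
            lab-eq  : lab G e ≡ lab K image
            allowed : ¬ target K image ∈ˢ F (target G e)
            origin  : (∃ λ σ → Fills σ e × Σ (σ ∈ˢ selection) λ σ∈ → φ M σ σ∈ ≡ image)
                    ⊎ (¬ (∃ λ σ → Fills σ e) × hi (occur K image) ≢ fin 1)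
        open Image

        slotFor : ∀ e → source G e ≡ n → Fin Multiplicity → Slot
        slotFor e p = combine (combine (φ L e p) (F (target G e)))

        imageOf : ∀ e → source G e ≡ n → Image e
        imageOf e p with any? (λ σ → fills? σ e)
        ... | yes (σ , f) = record
          { image = φ M σ σ∈
          ; from-t = source≡ M σ σ∈
          ; lab-eq = trans (lab≡ L e p′) (trans (cong (lab H) eq) (lab≡ M σ σ∈))
          ; allowed = λ t∈ → target-ok M σ σ∈ (subst (target K (φ M σ σ∈) ∈ˢ_) eq′ t∈)
          ; origin = inj₁ (σ , f , σ∈ , refl) }
          where
          σ∈ = ∈-toSet⁺ filled? (e , f)
          dec = decompose {σ} f
          p′ = proj₁ dec
          eq = proj₁ (proj₂ dec)
          eq′ = proj₂ (proj₂ dec)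
        ... | no unfilled with saturated _ (p , refl)
        ...   | inj₁ filled = contradiction filled unfilled
        -- `suc (#E K)` copies are mapped to `#E K` edges.
        ...   | inj₂ all∈ with pigeonhole ℕ.≤-refl (λ j → φ M (slotFor e p j) (all∈ j))
        ...     | j , j′ , j<j′ , eq = record
          { image = φ M (slotFor e p j) (all∈ j)
          ; from-t = source≡ M _ _
          ; lab-eq = trans (lab≡ L e p) (trans
              (cong (lab H) (sym (edgeOf-combine (φ L e p) (F (target G e)) j))) (lab≡ M _ (all∈ j)))
          ; allowed = λ t∈ → target-ok M _ (all∈ j) (subst (target K (φ M _ (all∈ j)) ∈ˢ_)
              (sym (failsOf-combine (φ L e p) (F (target G e)) j)) t∈)
          -- Under the upper bound 1, `M` would identify two slots whose copy numbers differ.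
          ; origin = inj₂ (unfilled , λ hi1 → <⇒≢ j<j′ (proj₂ (combine-injective {Colours} _ _ _ _
              (upper M _ (source≡ M _ _) hi1 _ _ (all∈ j) (all∈ j′) refl (sym eq))))) }

        extend : LocalIn F n t
        extend = record
          { φ = λ e p → image (imageOf e p)
          ; source≡ = λ e p → from-t (imageOf e p)
          ; lab≡ = λ e p → lab-eq (imageOf e p)
          ; target-ok = λ e p → allowed (imageOf e p)
          ; lower = lower-ok
          ; upper = λ f sf hf e e′ p p′ eq eq′ → unique-image f sf hf e e′ (imageOf e p) (imageOf e′ p′) eq eq′ }
          where
          -- The image may have been taken from a slot found by search, but an edge fills only one
          -- slot.
          image≡ : ∀ {σ e} (σ∈ : σ ∈ˢ selection) → Fills σ e → (I : Image e) → image I ≡ φ M σ σ∈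
          image≡ {σ} σ∈ f I with origin I
          ... | inj₁ (τ , f′ , τ∈ , eq) = trans (sym eq) (φ-irrelevant M τ∈ σ∈ (Fills-injective f′ f))
          ... | inj₂ (unfilled , _) = contradiction (σ , f) unfilled

          lower-ok : ∀ f → source K f ≡ t → lo (occur K f) ≡ 1 → ∃₂ λ e p → image (imageOf e p) ≡ f
          lower-ok f sf lf = let σ , σ∈ , eq = lower M f sf lf
                                 e , fl = filler σ∈
                                 p , _ = decompose {σ} fl
                             in e , p , trans (image≡ σ∈ fl (imageOf e p)) eq

          -- Over an edge with upper bound 1 neither edge can lack a slot; `M` then makes the slots
          -- equal, and a slot holds one edge.
          unique-image : ∀ f → source K f ≡ t → hi (occur K f) ≡ fin 1 →
                         ∀ e e′ (I : Image e) (I′ : Image e′) → image I ≡ f → image I′ ≡ f → e ≡ e′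
          unique-image f sf hf e e′ I I′ eq eq′ with origin I | origin I′
          ... | inj₂ (_ , many) | _ = contradiction (subst (λ f → hi (occur K f) ≡ fin 1) (sym eq) hf) many
          ... | inj₁ _ | inj₂ (_ , many) = contradiction (subst (λ f → hi (occur K f) ≡ fin 1) (sym eq′) hf) many
          ... | inj₁ (σ , fl , σ∈ , φ≡) | inj₁ (τ , fl′ , τ∈ , φ≡′) =
            Fills-functional {τ} (subst (λ σ → Fills σ e)
              (upper M f sf hf σ τ σ∈ τ∈ (trans φ≡ eq) (trans φ≡′ eq′)) fl) fl′

      -- By `extend`, a map of the selected slots to `t` would give a map of all out-edges, and an
      -- excluded `t` has none.
      derivable : ∀ {A : Fin (#N H) → Failing → Set} → (∀ n′ s′ → R n′ s′ → A s′ (F n′)) → Derivable A s (step F n)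
      derivable {A} sound = selection
        , (λ σ σ∈ → let e , f = filler σ∈ ; p , eq , eq′ = decompose {σ} f in
             subst (uncurry A) (cong₂ _,_ (cong (target H) eq) eq′)
               (sound (target G e) (target H (φ L e p)) (target-ok L e p)))
        , selection-localH
        , λ t t∈ M → ∈-toSet⁻ (λ t → ¬? (localIn? F n t)) t∈ (Extend.extend M)

    failing : ℕ → Fin (#N G) → Failing
    failing zero _ = ∅
    failing (suc i) = step (failing i)

    -- The start is empty, and more exclusions leave fewer local maps, so `step` is monotone.
    failing-increasing : ∀ {i} {n} {t : Fin (#N K)} → t ∈ˢ failing i n → t ∈ˢ failing (suc i) n
    failing-increasing {zero} t∈ = contradiction (∈-toSet⁻ {#N K} (λ t → no (λ (x : ⊥) → x)) t∈) id
    failing-increasing {suc i} {n} t∈ = ∈-toSet⁺ (λ t → ¬? (localIn? (failing (suc i)) n t)) λ L →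
      ∈-toSet⁻ (λ t → ¬? (localIn? (failing i) n t)) t∈
        (weaken (λ e t ¬t∈ → ¬t∈ ∘ failing-increasing {i}) L)

    failing-stabilises : ∃ λ i → ∀ n (t : Fin (#N K)) → t ∈ˢ failing (suc i) n → t ∈ˢ failing i n
    failing-stabilises = stabilises₂ (λ i n (t : Fin (#N K)) → t ∈ˢ failing i n)
      (λ i n t → t ∈ˢ? failing i n) (λ {i} → failing-increasing {i})

    -- Non-exclusion at a stable round is a simulation: a type without a local map would be excluded
    -- one round later. A node excluded from every type would yield a refutable pair with a full
    -- set.
    ∈L⇒∈L : IsShape K → ∀ depth →
            (∀ s F → Refutable (suc depth) s F → Refutable depth s F) →
            (¬ ∃₂ λ s F → Refutable depth s F × (∀ (t : Fin (#N K)) → t ∈ˢ F)) →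
            G ∈L H → G ∈L K
    ∈L⇒∈L shape depth closed irrefutable (simple@(ones , _) , R , sim , total) =
      simple , (λ n t → ¬ t ∈ˢ failing i n)
             , local⇒simulation G K ones _ shape (λ n t t∉ →
                 decidable-stable (localIn? (failing i) n t) λ ¬L →
                   t∉ (stable n t (∈-toSet⁺ (λ t → ¬? (localIn? (failing i) n t)) ¬L)))
             , typed
      where
      i = proj₁ failing-stabilises
      stable = proj₂ failing-stabilises

      -- Each refinement round of `G` is one derivation, and `closed` brings its result back to
      -- round `depth`.
      refutable : ∀ i n s → R n s → Refutable depth s (failing i n)
      refutable zero n s _ = start depth
        where
        start : ∀ depth → Refutable depth s ∅
        start zero t t∈ = ∈-toSet⁻ {#N K} (λ t → no (λ (x : ⊥) → x)) t∈
        start (suc d) = inj₁ (start d)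
      refutable (suc i) n s r = closed _ _ (inj₂ (Selection.derivable (failing i) n s
        (simulation⇒local G H ones R sim n s r) {Refutable depth} (refutable i)))

      typed : ∀ n → ∃ λ t → ¬ t ∈ˢ failing i n
      typed n with any? (λ t → ¬? (t ∈ˢ? failing i n))
      ... | yes found = found
      ... | no ¬found = contradiction
        (let s , r = total n in s , failing i n , refutable i n s r ,
          λ t → decidable-stable (t ∈ˢ? failing i n) (λ t∉ → ¬found (t , t∉))) irrefutable

  -- Size of the counterexample

  2^-bound : ∀ n → suc n ≤ 2 ^ n
  2^-bound zero = ℕ.≤-refl
  2^-bound (suc n) = ℕ.≤-trans (ℕ.+-mono-≤ (ℕ.m^n>0 2 n) (2^-bound n)) (ℕ.+-monoʳ-≤ (2 ^ n) (ℕ.m≤m+n _ 0))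

  -- With `x` the total size, `Kinds` is at most 2^(2x) and `Slots` at most 2^(3x). Hence there are
  -- at most 2^(5x+1) nodes and 2^(8x+1) candidate edges; their sum costs one more factor 2.
  size-bound : ∀ depth → size (Counterexample.graph depth) ≤ 2 ^ (2 + (size H + size K) * 8)
  size-bound depth = begin
    Nodes + count edges                ≤⟨ ℕ.+-mono-≤ nodes≤ (ℕ.≤-trans (bound edges) candidates≤) ⟩
    2 ^ (1 + x * 8) + 2 ^ (1 + x * 8)  ≡⟨ cong (2 ^ (1 + x * 8) +_) (sym (ℕ.+-identityʳ _)) ⟩
    2 ^ (2 + x * 8)                    ∎
    where
    open Counterexample depth
    open ℕ.≤-Reasoning
    x = size H + size K

    pow : ∀ {n} → n ≤ x → 2 ^ n ≤ 2 ^ x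
    pow = ℕ.^-monoʳ-≤ 2

    NH≤ : #N H ≤ x
    NH≤ = ℕ.≤-trans (ℕ.m≤m+n (#N H) (#E H)) (ℕ.m≤m+n (size H) (size K))
    EH≤ : #E H ≤ x
    EH≤ = ℕ.≤-trans (ℕ.m≤n+m (#E H) (#N H)) (ℕ.m≤m+n (size H) (size K))
    NK≤ : #N K ≤ x
    NK≤ = ℕ.≤-trans (ℕ.m≤m+n (#N K) (#E K)) (ℕ.m≤n+m (size K) (size H))
    EK≤ : #E K ≤ x
    EK≤ = ℕ.≤-trans (ℕ.m≤n+m (#E K) (#N K)) (ℕ.m≤n+m (size K) (size H))

    mul : ∀ {a b} m n → a ≤ 2 ^ m → b ≤ 2 ^ n → a * b ≤ 2 ^ (m + n)
    mul m n p q = ℕ.≤-trans (ℕ.*-mono-≤ p q) (ℕ.≤-reflexive (sym (ℕ.^-distribˡ-+-* 2 m n)))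

    below : ∀ {n} → n ≤ x → n ≤ 2 ^ x
    below {n} n≤ = ℕ.≤-trans (ℕ.n≤1+n n) (ℕ.≤-trans (2^-bound n) (pow n≤))

    kinds≤ : Kinds ≤ 2 ^ (x + x)
    kinds≤ = mul x x (below NH≤) (pow NK≤)

    slots≤ : Slots ≤ 2 ^ ((x + x) + x)
    slots≤ = mul (x + x) x (mul x x (below EH≤) (pow NK≤)) (ℕ.≤-trans (2^-bound (#E K)) (pow EK≤))

    1+slots≤ : suc Slots ≤ 2 ^ (1 + ((x + x) + x))
    1+slots≤ = ℕ.+-mono-≤ (ℕ.m^n>0 2 ((x + x) + x)) (ℕ.≤-trans slots≤ (ℕ.m≤m+n (2 ^ ((x + x) + x)) 0))

    nodes≤′ : Nodes ≤ 2 ^ ((x + x) + (1 + ((x + x) + x)))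
    nodes≤′ = mul (x + x) (1 + ((x + x) + x)) kinds≤ 1+slots≤

    exponent : ((x + x) + (1 + ((x + x) + x))) + ((x + x) + x) ≡ 1 + x * 8
    exponent = solve 1 (λ x → ((x :+ x) :+ (con 1 :+ ((x :+ x) :+ x))) :+ ((x :+ x) :+ x) := con 1 :+ x :* con 8)
      refl x
      where open +-*-Solver

    candidates≤ : Candidates ≤ 2 ^ (1 + x * 8)
    candidates≤ = subst (λ z → Candidates ≤ 2 ^ z) exponent
      (mul ((x + x) + (1 + ((x + x) + x))) ((x + x) + x) nodes≤′ slots≤)

    nodes≤ : Nodes ≤ 2 ^ (1 + x * 8)
    nodes≤ = ℕ.≤-trans nodes≤′ (ℕ.^-monoʳ-≤ 2 (ℕ.≤-trans
      (ℕ.m≤m+n ((x + x) + (1 + ((x + x) + x))) ((x + x) + x)) (ℕ.≤-reflexive exponent)))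

-- The two cases: inclusion or counterexample

theorem4 : (k : ℕ) → Σ Poly λ p →
    (H K : Graph k) → IsShape H → IsShape K → ¬ (H ⊆L K) →
    Σ (Graph k) λ G → G ∈L H × ¬ (G ∈L K) × size G ≤ 2 ^ eval p (size H + size K)
-- The polynomial 2 + 8x is the exponent in `size-bound`.
theorem4 k = 2 ∷ 8 ∷ [] , counterexample
  where
  counterexample : (H K : Graph k) → IsShape H → IsShape K → ¬ (H ⊆L K) →
    Σ (Graph k) λ G → G ∈L H × ¬ (G ∈L K) × size G ≤ 2 ^ eval (2 ∷ 8 ∷ []) (size H + size K)
  counterexample H K shapeH shapeK H⊈K = search (any? λ s → any? λ F → refutable? depth s F ×-dec all? λ t → t ∈ˢ? F)
    where
    open Refutation H K
    x = size H + size K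
    -- Refutability only grows with the round and there are finitely many pairs, so some `depth` is
    -- final.
    stable = stabilises₂ Refutable refutable? inj₁
    depth = proj₁ stable
    open Counterexample depth

    search : Dec (∃₂ λ s F → Refutable depth s F × (∀ (t : Fin (#N K)) → t ∈ˢ F)) →
      Σ (Graph k) λ G → G ∈L H × ¬ (G ∈L K) × size G ≤ 2 ^ eval (2 ∷ 8 ∷ []) x
    search (no irrefutable) = contradiction (λ G → ∈L⇒∈L G shapeK depth (proj₂ stable) irrefutable) H⊈K
    search (yes (s , F , r , full)) = graph , (simple , ≼H shapeH) , ⋠K r full ∘ proj₂ ,
      -- Horner evaluation leaves a summand `x * 0`.
      subst (λ y → size graph ≤ 2 ^ (2 + y))
        (cong (x *_) (cong (8 +_) (sym (ℕ.*-zeroʳ x)))) (size-bound depth)
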